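{- Let $k\ge 2$ and let $n_0,n_1,\dots,n_k$ be positive integers. Then $$\mathrm{F}([n_0;n_1,\dots,n_k]) = F^{(n_{k-1})}\,F_{n_k}+F^{(n_{k-1}-1)}\,F_{n_k+1},$$ where the integers $F^{(n_j)}$ and $F^{(n_j-1)}$, $1\le j\le k-1$, are defined recursively by $$F^{(n_1)}=F_{n_0}F_{n_1}+F_{n_0-1}F_{n_1+1},\qquad F^{(n_1-1)}=F_{n_0}F_{n_1-1}+F_{n_0-1}F_{n_1},$$ and, for $2\le j\le k-1$, $$F^{(n_j)}=F^{(n_{j-1})}F_{n_j}+F^{(n_{j-1}-1)}F_{n_j+1},\qquad F^{(n_j-1)}=F^{(n_{j-1})}F_{n_j-1}+F^{(n_{j-1}-1)}F_{n_j}.$$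
   Context: The symbols $F^{(n_j)}$ and $F^{(n_j-1)}$ are just names for two integers attached to position $j$ (depending on $n_0,\dots,n_j$). $[n_0;n_1,\dots,n_k]$ denotes the finite continued fraction $n_0+1/(n_1+1/(\cdots+1/n_k))$. The conumerator function is the unique map $\mathrm{con}:\mathbb{Q}_{>0}\to\mathbb{Z}_{>0}$ with $\mathrm{con}(1)=1$ and, for all $X\in\mathbb{Q}_{>0}$, $\mathrm{con}(1+X)=\mathrm{con}(X)+\mathrm{con}(1/X)$ and $\mathrm{con}\left(\tfrac{1}{1+X}\right)=\mathrm{con}(X)$. The codenominator function is $\mathrm{F}(X):=\mathrm{con}(1/X)$ for $X\in\mathbb{Q}_{>0}$; equivalently $\mathrm{F}(1)=1$, $\mathrm{F}(1+X)=\mathrm{F}(1/X)$, $\mathrm{F}\left(\tfrac{1}{1+X}\right)=\mathrm{F}(X)+\mathrm{F}(1/X)$. The Fibonacci numbers are $F_0=0$, $F_1=1$, $F_n=F_{n-1}+F_{n-2}$. -}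

module Defs where

open import Data.Fin.Base using (zero; suc)
open import Data.Integer.Base as ℤ using (+_; +[1+_])
import Data.Integer.Properties as ℤ
open import Data.Irrelevant using ([_])
open import Data.Nat.Base
  using (ℕ; zero; suc; pred; _+_; _*_; _<_; NonZero; Ordering; less; equal; greater; compare; s≤s⁻¹)
import Data.Nat.Coprimality as Coprime
open import Data.Nat.Divisibility using (_∣_; ∣m+n∣m⇒∣n)
import Data.Nat.Properties as ℕ
open import Data.Product.Base using (∃; _,_)
open import Data.Rational.Base as ℚ using (ℚ; mkℚ; 1ℚ)
import Data.Rational.Properties as ℚ
open import Data.Refinement using (Refinement; Refinement-syntax; _,_; value; value-injective)
open import Data.Vec.Functional using (Vector; head; tail; init; last)
open import Relation.Binary.PropositionalEquality

ℕ⁺ : Set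
ℕ⁺ = [ n ∈ ℕ ∣ NonZero n ]

ℚ⁺ : Set
ℚ⁺ = [ q ∈ ℚ ∣ ℚ.Positive q ]

1⁺ : ℚ⁺
1⁺ = 1ℚ , [ _ ]

infixl 6 _+⁺_
_+⁺_ : ℚ⁺ → ℚ⁺ → ℚ⁺
(p , [ p>0 ]) +⁺ (q , [ q>0 ]) = p ℚ.+ q , [ ℚ.pos+pos⇒pos p {{p>0}} q {{q>0}} ]

infix 8 1/⁺_
1/⁺_ : ℚ⁺ → ℚ⁺
1/⁺ (p , [ p>0 ]) =
  (ℚ.1/ p) {{ℚ.pos⇒nonZero p {{p>0}}}} , [ ℚ.1/pos⇒pos p {{p>0}} ]

fromℕ⁺ : ℕ⁺ → ℚ⁺
fromℕ⁺ (n , [ n≢0 ]) = (+ n) ℚ./ 1 , [ ℚ.normalize-pos n 1 {{_}} {{n≢0}} ]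

-- [ n₀ ; n₁ , … , nₖ ]
continuedFraction : ∀ {k} → Vector ℕ⁺ (suc k) → ℚ⁺
continuedFraction {zero}  n = fromℕ⁺ (head n)
continuedFraction {suc k} n = fromℕ⁺ (head n) +⁺ 1/⁺ continuedFraction (tail n)

-- The conumerator is the unique function with these properties; an explicit
-- one is constructed in `conumerator-exists` below.
record IsConumerator (con : ℚ⁺ → ℕ⁺) : Set where
  field
    con-1        : value (con 1⁺) ≡ 1
    con-1+X      : ∀ X → value (con (1⁺ +⁺ X)) ≡ value (con X) + value (con (1/⁺ X))
    con-1/[1+X]  : ∀ X → value (con (1/⁺ (1⁺ +⁺ X))) ≡ value (con X)

codenominator : (ℚ⁺ → ℕ⁺) → ℚ⁺ → ℕ⁺
codenominator con X = con (1/⁺ X)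

fib : ℕ → ℕ
fib 0             = 0
fib 1             = 1
fib (suc (suc n)) = fib (suc n) + fib n

-- F⁽ⁿ⁾ (n₀ , … , nⱼ) and F⁽ⁿ⁻¹⁾ (n₀ , … , nⱼ) are the integers written F^(nⱼ)
-- and F^(nⱼ-1), for j ≥ 1.  Since F^(nⱼ₋₁) and F^(nⱼ₋₁-1) depend on n₀ , … , nⱼ₋₁
-- only, they are obtained from the initial segment `init n`.
-- All entries are positive, so `pred` is never truncated.
F⁽ⁿ⁾ F⁽ⁿ⁻¹⁾ : ∀ {i} → Vector ℕ⁺ (2 + i) → ℕ

F⁽ⁿ⁾ {zero}  n = fib n₀ * fib n₁ + fib (pred n₀) * fib (n₁ + 1)
  where n₀ = value (n zero)
        n₁ = value (n (suc zero))
F⁽ⁿ⁾ {suc i} n = F⁽ⁿ⁾ (init n) * fib nⱼ + F⁽ⁿ⁻¹⁾ (init n) * fib (nⱼ + 1)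
  where nⱼ = value (last n)

F⁽ⁿ⁻¹⁾ {zero}  n = fib n₀ * fib (pred n₁) + fib (pred n₀) * fib n₁
  where n₀ = value (n zero)
        n₁ = value (n (suc zero))
F⁽ⁿ⁻¹⁾ {suc i} n = F⁽ⁿ⁾ (init n) * fib (pred nⱼ) + F⁽ⁿ⁻¹⁾ (init n) * fib nⱼ
  where nⱼ = value (last n)

private
  -- conℕ f n d is the conumerator of (1 + n) / (1 + d), for any fuel f > n + d.
  conℕ  : ℕ → ℕ → ℕ → ℕ
  step  : ℕ → ∀ {n d} → Ordering n d → ℕ

  conℕ zero    n d = 1
  conℕ (suc f) n d = step f (compare n d)

  step f (less m k)    = conℕ f k m
  step f (equal m)     = 1
  step f (greater m k) = conℕ f k m + conℕ f m k

  conℕ-fuel : ∀ f g n d → n + d < f → n + d < g → conℕ f n d ≡ conℕ g n d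
  conℕ-fuel (suc f) (suc g) n d n+d<f n+d<g with compare n d
  ... | equal m     = refl
  ... | less m k    = conℕ-fuel f g k m (bound n+d<f) (bound n+d<g)
    where
    bound : ∀ {h} → m + suc (m + k) < suc h → k + m < h
    bound lt = ℕ.≤-trans
      (ℕ.≤-reflexive (cong suc (ℕ.+-comm k m)))
      (ℕ.≤-trans (ℕ.m≤n+m (suc (m + k)) m) (s≤s⁻¹ lt))
  ... | greater m k = cong₂ _+_
    (conℕ-fuel f g k m (bound′ n+d<f) (bound′ n+d<g))
    (conℕ-fuel f g m k (bound n+d<f) (bound n+d<g))
    where
    bound : ∀ {h} → suc (m + k) + m < suc h → m + k < h
    bound lt = ℕ.≤-trans (ℕ.m≤m+n (suc (m + k)) m) (s≤s⁻¹ lt)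
    bound′ : ∀ {h} → suc (m + k) + m < suc h → k + m < h
    bound′ {h} lt = subst (_< h) (ℕ.+-comm m k) (bound lt)

  compare-greater : ∀ m k → compare (suc (m + k)) m ≡ greater m k
  compare-greater zero    k = refl
  compare-greater (suc m) k rewrite compare-greater m k = refl

  compare-less : ∀ m k → compare m (suc (m + k)) ≡ less m k
  compare-less zero    k = refl
  compare-less (suc m) k rewrite compare-less m k = refl

  conℕ>0 : ∀ f n d → NonZero (conℕ f n d)
  conℕ>0 zero    n d = _
  conℕ>0 (suc f) n d with compare n d
  ... | less m k    = conℕ>0 f k m
  ... | equal m     = _
  ... | greater m k with conℕ f k m | conℕ>0 f k m
  ...   | suc _ | _ = _

  con₀ : ℚ⁺ → ℕ⁺
  con₀ (mkℚ +[1+ n ] d _ , _) = conℕ f n d , [ conℕ>0 f n d ]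
    where f = suc (n + d)

  coprime-1+ : ∀ {n d} → Coprime.Coprime (suc n) (suc d) →
               Coprime.Coprime (suc (suc (d + n))) (suc d)
  coprime-1+ {n} {d} c {i} (i∣n+d , i∣d) =
    c (∣m+n∣m⇒∣n (subst (i ∣_) (cong suc (sym (ℕ.+-suc d n))) i∣n+d) i∣d , i∣d)

  1+-mkℚ : ∀ n d .(c : Coprime.Coprime (suc n) (suc d)) →
           1ℚ ℚ.+ mkℚ +[1+ n ] d c ≡ mkℚ +[1+ suc (d + n) ] d (coprime-1+ c)
  1+-mkℚ n d c = trans
    (ℚ.normalize-cong {{_}} {{_}} num (ℕ.+-identityʳ (suc d)))
    (ℚ.normalize-coprime (coprime-1+ c))
    where
    num : suc d + 0 + suc n * 1 ≡ suc (suc (d + n))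
    num = trans (cong₂ _+_ (ℕ.+-identityʳ (suc d)) (ℕ.*-identityʳ (suc n)))
                (cong suc (ℕ.+-suc d n))

  1+-ℚ⁺ : ∀ n d .(c : Coprime.Coprime (suc n) (suc d)) →
          1⁺ +⁺ (mkℚ +[1+ n ] d c , [ _ ]) ≡
          (mkℚ +[1+ suc (d + n) ] d (coprime-1+ c) , [ _ ])
  1+-ℚ⁺ n d c = value-injective (1+-mkℚ n d c)

  con₀-1+X : ∀ X → value (con₀ (1⁺ +⁺ X)) ≡ value (con₀ X) + value (con₀ (1/⁺ X))
  con₀-1+X (mkℚ +[1+ n ] d c , [ _ ]) =
    trans (cong (λ Y → value (con₀ Y)) (1+-ℚ⁺ n d c))
   (trans (cong (step (suc (d + n + d))) (compare-greater d n))
          (cong₂ _+_ (conℕ-fuel _ _ n d lt (ℕ.n<1+n (n + d)))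
                     (conℕ-fuel _ _ d n lt′ (ℕ.n<1+n (d + n)))))
    where
    lt′ : d + n < suc (d + n + d)
    lt′ = ℕ.m≤m+n (suc (d + n)) d
    lt : n + d < suc (d + n + d)
    lt = subst (_< suc (d + n + d)) (ℕ.+-comm d n) lt′

  con₀-1/[1+X] : ∀ X → value (con₀ (1/⁺ (1⁺ +⁺ X))) ≡ value (con₀ X)
  con₀-1/[1+X] (mkℚ +[1+ n ] d c , [ _ ]) =
    trans (cong (λ Y → value (con₀ (1/⁺ Y))) (1+-ℚ⁺ n d c))
   (trans (cong (step (d + suc (d + n))) (compare-less d n))
          (conℕ-fuel _ _ n d lt (ℕ.n<1+n (n + d))))
    where
    lt : n + d < d + suc (d + n)
    lt = subst (_< d + suc (d + n)) (ℕ.+-comm d n) (ℕ.m≤n+m (suc (d + n)) d)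

conumerator-exists : ∃ IsConumerator
conumerator-exists = con₀ , record
  { con-1       = refl
  ; con-1+X     = con₀-1+X
  ; con-1/[1+X] = con₀-1/[1+X]
  }

{-# OPTIONS --safe #-}

-- Put (a , b) = (con X , F X).  Adding 1 to X sends (a , b) to (a + b , a), so
-- adding m to X acts by fib (m + 1), fib m, fib (m - 1), while X ↦ 1/X swaps a
-- and b.  Prepending partial quotients to Y thus multiplies (F Y , con Y) by
-- Fibonacci matrices; (F⁽ⁿ⁾ , F⁽ⁿ⁻¹⁾) is the first row of their product.
module Submission where

open import Defs
open import Data.Irrelevant using ([_])
open import Data.Integer.Base using (+_; +[1+_])
open import Data.Nat.Base using (ℕ; zero; suc; pred; _+_; _*_)
open import Data.Nat.Coprimality as Coprime using (1-coprimeTo)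
import Data.Nat.Properties as ℕ
open import Data.Nat.Tactic.RingSolver using (solve-∀)
open import Data.Rational.Base as ℚ using (mkℚ; 1ℚ)
import Data.Rational.Properties as ℚ
open import Data.Refinement using (value; value-injective; _,_)
open import Data.Vec.Functional using (Vector; head; tail; init; last; foldr)
open import Relation.Binary.PropositionalEquality
  using (_≡_; refl; sym; trans; cong; cong₂; module ≡-Reasoning)
open ≡-Reasoning

+⁺-assoc : ∀ X Y Z → (X +⁺ Y) +⁺ Z ≡ X +⁺ (Y +⁺ Z)
+⁺-assoc (p , _) (q , _) (r , _) = value-injective (ℚ.+-assoc p q r)

1/⁺-involutive : ∀ X → 1/⁺ 1/⁺ X ≡ X
1/⁺-involutive (mkℚ +[1+ _ ] _ _ , _) = refl

suc⁺ : ℕ → ℕ⁺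
suc⁺ m = suc m , [ _ ]

-- The conumerator equations only describe `1⁺ +⁺ X`, so an integer is unwound one unit at a time.
fromℕ⁺-suc : ∀ m → fromℕ⁺ (suc⁺ (suc m)) ≡ 1⁺ +⁺ fromℕ⁺ (suc⁺ m)
fromℕ⁺-suc m = value-injective (sym (begin
  1ℚ ℚ.+ (+[1+ m ] ℚ./ 1)
    -- The quotient is stuck on a gcd for variable `m`. In the `mkℚ` form the numerator of the sum
    -- computes, up to a factor 1.
    ≡⟨ cong (1ℚ ℚ.+_) (ℚ.normalize-coprime coprime) ⟩
  1ℚ ℚ.+ mkℚ +[1+ m ] 0 coprime
    ≡⟨ cong (λ k → + suc k ℚ./ 1) (ℕ.*-identityʳ (suc m)) ⟩
  +[1+ suc m ] ℚ./ 1
    ∎))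
  where coprime = Coprime.sym (1-coprimeTo (suc m))

_+1/_ : ℕ⁺ → ℚ⁺ → ℚ⁺
m +1/ Y = fromℕ⁺ m +⁺ 1/⁺ Y

-- The last quotient has no reciprocal after it, so it serves as the seed. As a fold, the fraction
-- can be unrolled from either end.
continuedFraction-foldr : ∀ {k} (n : Vector ℕ⁺ (suc k)) →
  continuedFraction n ≡ foldr _+1/_ (fromℕ⁺ (last n)) (init n)
continuedFraction-foldr {zero}  n = refl
continuedFraction-foldr {suc k} n = cong (head n +1/_) (continuedFraction-foldr (tail n))

-- Needed because `F⁽ⁿ⁾` recurses on `init`, whereas `foldr` peels off the head.
foldr-init-last : ∀ {a b} {A : Set a} {B : Set b} (f : A → B → B) (e : B)
  {k} (xs : Vector A (suc k)) → foldr f e xs ≡ foldr f (f (last xs) e) (init xs)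
foldr-init-last f e {zero}  xs = refl
foldr-init-last f e {suc k} xs = cong (f (head xs)) (foldr-init-last f e (tail xs))

module Conumerator (con : ℚ⁺ → ℕ⁺) (isCon : IsConumerator con) where
  open IsConumerator isCon

  C F : ℚ⁺ → ℕ
  C X = value (con X)
  F X = value (codenominator con X)

  -- Mutual induction on `m`: a further unit makes `C` the old `C` plus the old `F`, and `F` the old
  -- `C`.
  C-fromℕ⁺-+ : ∀ m X → C (fromℕ⁺ (suc⁺ m) +⁺ X) ≡ fib (suc (suc m)) * C X + fib (suc m) * F X
  F-fromℕ⁺-+ : ∀ m X → F (fromℕ⁺ (suc⁺ m) +⁺ X) ≡ fib (suc m) * C X + fib m * F X

  C-fromℕ⁺-+ zero X = trans (con-1+X X) (cong₂ _+_ (sym (ℕ.*-identityˡ (C X))) (sym (ℕ.*-identityˡ (F X))))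
  C-fromℕ⁺-+ (suc m) X = begin
    C (fromℕ⁺ (suc⁺ (suc m)) +⁺ X)
      ≡⟨ cong (λ Y → C (Y +⁺ X)) (fromℕ⁺-suc m) ⟩
    C ((1⁺ +⁺ M) +⁺ X)
      ≡⟨ cong C (+⁺-assoc 1⁺ M X) ⟩
    C (1⁺ +⁺ (M +⁺ X))
      ≡⟨ con-1+X (M +⁺ X) ⟩
    C (M +⁺ X) + F (M +⁺ X)
      ≡⟨ cong₂ _+_ (C-fromℕ⁺-+ m X) (F-fromℕ⁺-+ m X) ⟩
    fib (2 + m) * C X + fib (1 + m) * F X + (fib (1 + m) * C X + fib m * F X)
      ≡⟨ regroup (fib (2 + m)) (fib (1 + m)) (fib m) (C X) (F X) ⟩
    fib (3 + m) * C X + fib (2 + m) * F X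
      ∎
    where
    M = fromℕ⁺ (suc⁺ m)
    regroup : ∀ p q r a b → p * a + q * b + (q * a + r * b) ≡ (p + q) * a + (q + r) * b
    regroup = solve-∀

  F-fromℕ⁺-+ zero X = trans (con-1/[1+X] X) (sym (trans (ℕ.+-identityʳ _) (ℕ.*-identityˡ _)))
  F-fromℕ⁺-+ (suc m) X = begin
    F (fromℕ⁺ (suc⁺ (suc m)) +⁺ X)
      ≡⟨ cong (λ Y → F (Y +⁺ X)) (fromℕ⁺-suc m) ⟩
    F ((1⁺ +⁺ M) +⁺ X)
      ≡⟨ cong F (+⁺-assoc 1⁺ M X) ⟩
    F (1⁺ +⁺ (M +⁺ X))
      ≡⟨ con-1/[1+X] (M +⁺ X) ⟩
    C (M +⁺ X)
      ≡⟨ C-fromℕ⁺-+ m X ⟩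
    fib (2 + m) * C X + fib (1 + m) * F X
      ∎
    where M = fromℕ⁺ (suc⁺ m)

  -- Formally the previous pair at `X = 0`, with values 1 for `C` and 0 for `F`. Since 0 is not in
  -- `ℚ⁺`, the induction is rerun from `con-1`.
  C-fromℕ⁺-suc : ∀ m → C (fromℕ⁺ (suc⁺ m)) ≡ fib (suc (suc m))
  F-fromℕ⁺-suc : ∀ m → F (fromℕ⁺ (suc⁺ m)) ≡ fib (suc m)

  C-fromℕ⁺-suc zero    = con-1
  C-fromℕ⁺-suc (suc m) = begin
    C (fromℕ⁺ (suc⁺ (suc m)))
      ≡⟨ cong C (fromℕ⁺-suc m) ⟩
    C (1⁺ +⁺ fromℕ⁺ (suc⁺ m))
      ≡⟨ con-1+X (fromℕ⁺ (suc⁺ m)) ⟩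
    C (fromℕ⁺ (suc⁺ m)) + F (fromℕ⁺ (suc⁺ m))
      ≡⟨ cong₂ _+_ (C-fromℕ⁺-suc m) (F-fromℕ⁺-suc m) ⟩
    fib (3 + m)
      ∎

  F-fromℕ⁺-suc zero    = con-1
  F-fromℕ⁺-suc (suc m) = begin
    F (fromℕ⁺ (suc⁺ (suc m)))
      ≡⟨ cong F (fromℕ⁺-suc m) ⟩
    F (1⁺ +⁺ fromℕ⁺ (suc⁺ m))
      ≡⟨ con-1/[1+X] (fromℕ⁺ (suc⁺ m)) ⟩
    C (fromℕ⁺ (suc⁺ m))
      ≡⟨ C-fromℕ⁺-suc m ⟩
    fib (2 + m)
      ∎

  C-fromℕ⁺ : ∀ m → C (fromℕ⁺ m) ≡ fib (value m + 1)
  C-fromℕ⁺ (suc m , _) = trans (C-fromℕ⁺-suc m) (cong fib (ℕ.+-comm 1 (suc m)))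

  F-fromℕ⁺ : ∀ m → F (fromℕ⁺ m) ≡ fib (value m)
  F-fromℕ⁺ (suc m , _) = F-fromℕ⁺-suc m

  C-+1/ : ∀ m Y → C (m +1/ Y) ≡ fib (value m + 1) * F Y + fib (value m) * C Y
  C-+1/ (suc m , _) Y = begin
    C (suc⁺ m +1/ Y)
      ≡⟨ C-fromℕ⁺-+ m (1/⁺ Y) ⟩
    fib (2 + m) * F Y + fib (suc m) * F (1/⁺ Y)
      -- `C (1/⁺ Y)` is `F Y` by definition, but `F (1/⁺ Y)` is `C (1/⁺ 1/⁺ Y)`, which needs the
      -- involution.
      ≡⟨ cong₂ (λ k X → fib k * F Y + fib (suc m) * C X) (ℕ.+-comm 1 (suc m)) (1/⁺-involutive Y) ⟩
    fib (suc m + 1) * F Y + fib (suc m) * C Y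
      ∎

  F-+1/ : ∀ m Y → F (m +1/ Y) ≡ fib (value m) * F Y + fib (pred (value m)) * C Y
  F-+1/ (suc m , _) Y = begin
    F (suc⁺ m +1/ Y)
      ≡⟨ F-fromℕ⁺-+ m (1/⁺ Y) ⟩
    fib (suc m) * F Y + fib m * F (1/⁺ Y)
      ≡⟨ cong (λ X → fib (suc m) * F Y + fib m * C X) (1/⁺-involutive Y) ⟩
    fib (suc m) * F Y + fib m * C Y
      ∎

  -- The row `(p , q)` is multiplied by the matrix of one quotient. The new coefficients have the
  -- shape of the recursion for `F⁽ⁿ⁾` and `F⁽ⁿ⁻¹⁾`.
  combination-+1/ : ∀ p q m Y → p * F (m +1/ Y) + q * C (m +1/ Y) ≡
    (p * fib (value m) + q * fib (value m + 1)) * F Y +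
    (p * fib (pred (value m)) + q * fib (value m)) * C Y
  combination-+1/ p q m Y = trans
    (cong₂ (λ s t → p * s + q * t) (F-+1/ m Y) (C-+1/ m Y))
    (regroup p q (fib (value m + 1)) (fib (value m)) (fib (pred (value m))) (F Y) (C Y))
    where
    regroup : ∀ p q u v w f c → p * (v * f + w * c) + q * (u * f + v * c) ≡
              (p * v + q * u) * f + (p * w + q * v) * c
    regroup = solve-∀

  -- `Y` must stay arbitrary: the induction moves the last quotient into the seed.
  F-foldr : ∀ {i} (n : Vector ℕ⁺ (2 + i)) Y →
    F (foldr _+1/_ Y n) ≡ F⁽ⁿ⁾ n * F Y + F⁽ⁿ⁻¹⁾ n * C Y
  F-foldr {zero} n Y = trans
    -- The quotient `n₀` supplies the initial row, and `n₁` then acts on it.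
    (F-+1/ n₀ (n₁ +1/ Y))
    (combination-+1/ (fib (value n₀)) (fib (pred (value n₀))) n₁ Y)
    where
    n₀ = head n
    n₁ = last n
  F-foldr {suc i} n Y = begin
    F (foldr _+1/_ Y n)
      ≡⟨ cong F (foldr-init-last _+1/_ Y n) ⟩
    F (foldr _+1/_ (last n +1/ Y) (init n))
      ≡⟨ F-foldr (init n) (last n +1/ Y) ⟩
    F⁽ⁿ⁾ (init n) * F (last n +1/ Y) + F⁽ⁿ⁻¹⁾ (init n) * C (last n +1/ Y)
      ≡⟨ combination-+1/ (F⁽ⁿ⁾ (init n)) (F⁽ⁿ⁻¹⁾ (init n)) (last n) Y ⟩
    F⁽ⁿ⁾ n * F Y + F⁽ⁿ⁻¹⁾ n * C Y
      ∎

lemma4p2 : ∀ (con : ℚ⁺ → ℕ⁺) → IsConumerator con →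
    ∀ (i : ℕ) → let k = 2 + i in
    ∀ (n : Vector ℕ⁺ (suc k)) →
    value (codenominator con (continuedFraction n))
    ≡ F⁽ⁿ⁾ (init n) * fib (value (last n)) + F⁽ⁿ⁻¹⁾ (init n) * fib (value (last n) + 1)
lemma4p2 con isCon i n = begin
  F (continuedFraction n)
    ≡⟨ cong F (continuedFraction-foldr n) ⟩
  F (foldr _+1/_ (fromℕ⁺ (last n)) (init n))
    ≡⟨ F-foldr (init n) (fromℕ⁺ (last n)) ⟩
  F⁽ⁿ⁾ (init n) * F (fromℕ⁺ (last n)) + F⁽ⁿ⁻¹⁾ (init n) * C (fromℕ⁺ (last n))
    -- The seed is an integer, so both of its values are Fibonacci numbers.
    ≡⟨ cong₂ (λ s t → F⁽ⁿ⁾ (init n) * s + F⁽ⁿ⁻¹⁾ (init n) * t)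
             (F-fromℕ⁺ (last n)) (C-fromℕ⁺ (last n)) ⟩
  F⁽ⁿ⁾ (init n) * fib (value (last n)) + F⁽ⁿ⁻¹⁾ (init n) * fib (value (last n) + 1)
    ∎
  where open Conumerator con isCon
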